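{- Let $G_5$ be the graph with vertex set $\{x,y_1,\dots,y_6,u_1,\dots,u_5,v_1,\dots,v_5\}$ and edge set $\{xy_i : i=1,\dots,6\}\cup\{y_iu_i,\ u_iv_i,\ v_iy_{i+1} : i=1,\dots,5\}$. Then $G_5$ is $(\frac{4}{2},2)^*$-colorable, but is not $(\frac{4}{2},1)^*$-colorable.
   Context: Graphs are finite, undirected and simple. For a positive integer $k$ and $i,j\in\{0,1,\dots,k-1\}$, the circular distance is $|i-j|_k=\min\{|i-j|,\,k-|i-j|\}$. For a nonnegative integer $t$, a $(\frac{k}{2},t)^*$-coloring of a graph $G$ is a mapping $f:V(G)\to\{0,1,\dots,k-1\}$ such that adjacent vertices receive different integers and, for each vertex $u$, the number of neighbors $v$ of $u$ with $|f(u)-f(v)|_k=1$ is at most $t$. $G$ is $(\frac{k}{2},t)^*$-colorable if it has such a coloring. (The symbol $\frac{k}{2}$ is formal notation recording the pair $(k,2)$, not a reduced fraction; so $\frac{4}{2}$ means $k=4$.) -}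

module Defs where

open import Data.Fin.Base using (Fin; suc; toℕ; inject₁)
open import Data.Fin.Properties using () renaming (_≟_ to _≟ᶠ_)
open import Data.List.Base using (List; _∷_; _++_; map; filter; length; allFin)
open import Data.List.Membership.Propositional using (_∈_)
open import Data.List.Membership.Propositional.Properties
  using (∈-map⁺; ∈-map⁻; ∈-++⁺ˡ; ∈-++⁺ʳ; ∈-++⁻; ∈-allFin)
open import Data.List.Relation.Binary.Disjoint.Propositional using (Disjoint)
open import Data.List.Relation.Unary.All using (tabulate)
open import Data.List.Relation.Unary.AllPairs using (_∷_)
open import Data.List.Relation.Unary.Any using (here; there)
open import Data.List.Relation.Unary.Unique.Propositional using (Unique)
open import Data.List.Relation.Unary.Unique.Propositional.Properties
  using (map⁺; ++⁺; allFin⁺)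
open import Data.Nat.Base using (ℕ; _≤_; _⊓_; _∸_; ∣_-_∣; NonZero)
open import Data.Nat.Properties using (_≟_)
open import Data.Product.Base using (∃; _×_; _,_)
open import Data.Sum.Base using (inj₁; inj₂)
open import Level using (0ℓ)
open import Relation.Binary.Core using (Rel)
open import Relation.Binary.Construct.Closure.Symmetric
  using (SymClosure; fwd; bwd; symmetric)
open import Relation.Binary.Definitions using (Decidable; Symmetric; Irreflexive)
open import Relation.Binary.PropositionalEquality using (_≡_; _≢_; refl)
open import Relation.Nullary.Decidable using (yes; no; map′; _×-dec_; _⊎-dec_)

record Graph : Set₁ where
  field
    Vertex   : Set
    Adj      : Rel Vertex 0ℓ
    irrefl   : Irreflexive _≡_ Adj
    sym      : Symmetric Adj
    adj?     : Decidable Adj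
    -- `vertices` lists every vertex exactly once, so counting along it is
    -- counting vertices.
    vertices : List Vertex
    complete : ∀ a → a ∈ vertices
    unique   : Unique vertices

circDist : ∀ {k} → Fin k → Fin k → ℕ
circDist {k} i j = d ⊓ (k ∸ d)
  where d = ∣ toℕ i - toℕ j ∣

module _ (G : Graph) where
  open Graph G

  defect : ∀ {k} → (Vertex → Fin k) → Vertex → ℕ
  defect f a =
    length (filter (λ b → adj? a b ×-dec (circDist (f a) (f b) ≟ 1)) vertices)

  -- (k/2 , t)*-colorings.  The 2 in the traditional notation is formal, so
  -- only k and t appear as parameters.
  record IsColoring (k t : ℕ) .{{_ : NonZero k}} (f : Vertex → Fin k) : Set where
    field
      proper    : ∀ {a b} → Adj a b → f a ≢ f b
      defective : ∀ a → defect f a ≤ t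

  Colorable : (k t : ℕ) .{{_ : NonZero k}} → Set
  Colorable k t = ∃ λ (f : Vertex → Fin k) → IsColoring k t f

module G₅-Construction where

  data V : Set where
    x : V
    y : Fin 6 → V
    u : Fin 5 → V
    v : Fin 5 → V

  -- One orientation of each edge.  Indices start at 0, so `inject₁ i` and
  -- `suc i` are the positions of i and i + 1 among the six y-vertices.
  data Edge : Rel V 0ℓ where
    xy : ∀ i → Edge x (y i)
    yu : ∀ i → Edge (y (inject₁ i)) (u i)
    uv : ∀ i → Edge (u i) (v i)
    vy : ∀ i → Edge (v i) (y (suc i))

  edge? : Decidable Edge
  edge? x     x     = no λ ()
  edge? x     (y i) = yes (xy i)
  edge? x     (u _) = no λ ()
  edge? x     (v _) = no λ ()
  edge? (y _) x     = no λ ()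
  edge? (y _) (y _) = no λ ()
  edge? (y i) (u j) = map′ (λ { refl → yu j }) (λ { (yu _) → refl }) (i ≟ᶠ inject₁ j)
  edge? (y _) (v _) = no λ ()
  edge? (u _) x     = no λ ()
  edge? (u _) (y _) = no λ ()
  edge? (u _) (u _) = no λ ()
  edge? (u i) (v j) = map′ (λ { refl → uv i }) (λ { (uv _) → refl }) (i ≟ᶠ j)
  edge? (v _) x     = no λ ()
  edge? (v i) (y j) = map′ (λ { refl → vy i }) (λ { (vy _) → refl }) (suc i ≟ᶠ j)
  edge? (v _) (u _) = no λ ()
  edge? (v _) (v _) = no λ ()

  Adj : Rel V 0ℓ
  Adj = SymClosure Edge

  adj? : Decidable Adj
  adj? a b = map′ (λ { (inj₁ e) → fwd e ; (inj₂ e) → bwd e })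
                  (λ { (fwd e) → inj₁ e ; (bwd e) → inj₂ e })
                  (edge? a b ⊎-dec edge? b a)

  irrefl : Irreflexive _≡_ Adj
  irrefl refl (fwd ())
  irrefl refl (bwd ())

  ys us vs vertices : List V
  ys = map y (allFin 6)
  us = map u (allFin 5)
  vs = map v (allFin 5)
  vertices = x ∷ ys ++ us ++ vs

  complete : ∀ a → a ∈ vertices
  complete x     = here refl
  complete (y i) = there (∈-++⁺ˡ (∈-map⁺ y (∈-allFin i)))
  complete (u i) = there (∈-++⁺ʳ ys (∈-++⁺ˡ (∈-map⁺ u (∈-allFin i))))
  complete (v i) = there (∈-++⁺ʳ ys (∈-++⁺ʳ us (∈-map⁺ v (∈-allFin i))))

  unique : Unique vertices
  unique =
    tabulate x∉ ∷
    ++⁺ (map⁺ {f = y} (λ { refl → refl }) (allFin⁺ 6))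
        (++⁺ (map⁺ {f = u} (λ { refl → refl }) (allFin⁺ 5))
             (map⁺ {f = v} (λ { refl → refl }) (allFin⁺ 5))
             us#vs)
        ys#us++vs
    where
    us#vs : Disjoint us vs
    us#vs (p , q) with ∈-map⁻ u p | ∈-map⁻ v q
    ... | _ , _ , refl | _ , _ , ()
    ys#us++vs : Disjoint ys (us ++ vs)
    ys#us++vs (p , q) with ∈-map⁻ y p | ∈-++⁻ us q
    ... | _ , _ , refl | inj₁ r with ∈-map⁻ u r
    ...   | _ , _ , ()
    ys#us++vs (p , q) | _ , _ , refl | inj₂ r with ∈-map⁻ v r
    ...   | _ , _ , ()
    x∉ : ∀ {b} → b ∈ ys ++ us ++ vs → x ≢ b
    x∉ p refl with ∈-++⁻ ys p
    ... | inj₁ q with ∈-map⁻ y q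
    ...   | _ , _ , ()
    x∉ p refl | inj₂ q with ∈-++⁻ us q
    ...   | inj₁ r with ∈-map⁻ u r
    ...     | _ , _ , ()
    x∉ p refl | inj₂ q | inj₂ r with ∈-map⁻ v r
    ...     | _ , _ , ()

G₅ : Graph
G₅ = record
  { Vertex   = V
  ; Adj      = Adj
  ; irrefl   = irrefl
  ; sym      = symmetric Edge
  ; adj?     = adj?
  ; vertices = vertices
  ; complete = complete
  ; unique   = unique
  }
  where open G₅-Construction

{-# OPTIONS --safe #-}
-- In ℤ/4, two distinct integers are at circular distance 1 or 2.  The
-- 4-coloring x ↦ 0, yᵢ ↦ 2, uᵢ ↦ 1, vᵢ ↦ 3 has defect at most 2.  In a coloring
-- of defect at most 1, at most one yᵢ is at distance 1 from x, so y₁, y₂, y₃ or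
-- y₄, y₅, y₆ all receive the integer opposite to that of x.  A path y u v y′
-- whose ends have the same integer has exactly two steps of length 1 (by parity,
-- and because 2 + 2 + 2 ≢ 0); they cannot meet at u or v, so they are y u and
-- v y′.  Two such consecutive paths give their common end defect 2.
module Submission where

open import Defs
open import Data.Empty using (⊥)
open import Data.Fin.Base using (Fin; suc; inject₁)
open import Data.Fin.Patterns using (0F; 1F; 2F; 3F; 4F; 5F)
open import Data.Fin.Properties using (all?) renaming (_≟_ to _≟ᶠ_)
open import Data.List.Base using (List; length)
open import Data.List.Membership.Propositional using (_∈_)
open import Data.List.Membership.Propositional.Properties using (∈-filter⁺; ∈-length)
open import Data.List.Relation.Unary.Any using (here; there)
open import Data.Nat.Base using (_≤_; _<_; s≤s; NonZero; nonZero)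
open import Data.Nat.Properties using (_≟_; _≤?_; ≤⇒≯; m≤n⇒m≤1+n)
open import Data.Product.Base using (_×_; _,_; proj₁; proj₂)
open import Relation.Binary.Construct.Closure.Symmetric using (fwd; bwd)
open import Relation.Binary.PropositionalEquality using (_≡_; _≢_; refl)
open import Relation.Nullary.Decidable using (_×-dec_; _→-dec_; ¬?; from-yes)
open import Relation.Nullary.Negation.Core using (¬_; contradiction)

∈-distinct⇒1<length : ∀ {A : Set} {a b : A} {xs : List A} →
                      a ≢ b → a ∈ xs → b ∈ xs → 1 < length xs
∈-distinct⇒1<length a≢b (here refl) (here refl) = contradiction refl a≢b
∈-distinct⇒1<length a≢b (here _)    (there q)   = s≤s (∈-length q)
∈-distinct⇒1<length a≢b (there p)   (here _)    = s≤s (∈-length p)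
∈-distinct⇒1<length a≢b (there p)   (there q)   = m≤n⇒m≤1+n (∈-distinct⇒1<length a≢b p q)

Close : ∀ {k} → Fin k → Fin k → Set
Close i j = circDist i j ≡ 1

module _ (G : Graph) where
  open Graph G

  -- Both neighbours would be entries of the list whose length is the defect, pushing it above 1.
  -- The defect bound is used below only in this form.
  close-neighbours-unique : ∀ {k} .{{_ : NonZero k}} {f : Vertex → Fin k} →
    IsColoring G k 1 f → ∀ {a b c} → b ≢ c → Adj a b → Adj a c →
    ¬ (Close (f a) (f b) × Close (f a) (f c))
  close-neighbours-unique {f = f} col {a} {b} {c} b≢c ab ac (pb , pc) =
    ≤⇒≯ (IsColoring.defective col a)
        (∈-distinct⇒1<length b≢c (member ab pb) (member ac pc))
    where
    member : ∀ {b} → Adj a b → Close (f a) (f b) → b ∈ _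
    member {b} ab p =
      ∈-filter⁺ (λ b → adj? a b ×-dec (circDist (f a) (f b) ≟ 1)) (complete b) (ab , p)

-- Modulo 4 only `c + 2` remains; decided by running through all cases.
far-unique : ∀ (c i j : Fin 4) → c ≢ i → c ≢ j → ¬ Close c i → ¬ Close c j → i ≡ j
far-unique = from-yes (all? λ (c : Fin 4) → all? λ i → all? λ j →
  ¬? (c ≟ᶠ i) →-dec ¬? (c ≟ᶠ j) →-dec
  ¬? (circDist c i ≟ 1) →-dec ¬? (circDist c j ≟ 1) →-dec (i ≟ᶠ j))

-- Here `d` is the common color of both ends of a path, so its colors form a closed walk. Its two
-- steps of length 1 share a corner, and the last two hypotheses rule out `p` and `q`.
closed-3-walk : ∀ (d p q : Fin 4) → d ≢ p → p ≢ q → q ≢ d →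
                ¬ (Close p d × Close p q) → ¬ (Close q p × Close q d) →
                Close d p × Close d q
closed-3-walk = from-yes (all? λ (d : Fin 4) → all? λ p → all? λ q →
  ¬? (d ≟ᶠ p) →-dec ¬? (p ≟ᶠ q) →-dec ¬? (q ≟ᶠ d) →-dec
  ¬? ((circDist p d ≟ 1) ×-dec (circDist p q ≟ 1)) →-dec
  ¬? ((circDist q p ≟ 1) ×-dec (circDist q d ≟ 1)) →-dec
  ((circDist d p ≟ 1) ×-dec (circDist d q ≟ 1)))

open G₅-Construction

G₅-colorable-4-2 : Colorable G₅ 4 2
G₅-colorable-4-2 = f , record { proper = proper ; defective = defective }
  where
  f : V → Fin 4
  f x     = 0F
  f (y _) = 2F
  f (u _) = 1F
  f (v _) = 3F

  proper : ∀ {a b} → Adj a b → f a ≢ f b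
  proper (fwd (xy _)) ()
  proper (fwd (yu _)) ()
  proper (fwd (uv _)) ()
  proper (fwd (vy _)) ()
  proper (bwd (xy _)) ()
  proper (bwd (yu _)) ()
  proper (bwd (uv _)) ()
  proper (bwd (vy _)) ()

  defective : ∀ a → defect G₅ f a ≤ 2
  defective x     = from-yes (defect G₅ f x ≤? 2)
  -- Only here is 2 attained: the edges of length 1 are exactly those joining some `y i` to a `u` or
  -- a `v`.
  defective (y i) = from-yes (all? λ i → defect G₅ f (y i) ≤? 2) i
  defective (u i) = from-yes (all? λ i → defect G₅ f (u i) ≤? 2) i
  defective (v i) = from-yes (all? λ i → defect G₅ f (v i) ≤? 2) i

module _ {f : V → Fin 4} (col : IsColoring G₅ 4 1 f) where
  open IsColoring col

  block : ∀ i → f (y (inject₁ i)) ≡ f (y (suc i)) →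
          Close (f (y (inject₁ i))) (f (u i)) × Close (f (y (suc i))) (f (v i))
  block i eq
    with f (y (inject₁ i)) | f (y (suc i)) | eq
       | proper (fwd (yu i)) | proper (fwd (vy i))
       | close-neighbours-unique G₅ col {u i} (λ ()) (bwd (yu i)) (fwd (uv i))
       | close-neighbours-unique G₅ col {v i} (λ ()) (bwd (uv i)) (fwd (vy i))
  ... | d | _ | refl | d≢p | q≢d | at-u | at-v =
    closed-3-walk d (f (u i)) (f (v i)) d≢p (proper (fwd (uv i))) q≢d at-u at-v

  CloseToX : Fin 6 → Set
  CloseToX j = Close (f x) (f (y j))

  far-from-x⇒≡ : ∀ i j → ¬ CloseToX i → ¬ CloseToX j → f (y i) ≡ f (y j)
  far-from-x⇒≡ i j = far-unique (f x) (f (y i)) (f (y j)) (proper (fwd (xy i))) (proper (fwd (xy j)))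

  ¬three-consecutive-far : ∀ (i : Fin 4) → ¬ CloseToX (inject₁ (inject₁ i)) →
    ¬ CloseToX (suc (inject₁ i)) → ¬ ¬ CloseToX (suc (suc i))
  ¬three-consecutive-far i far₀ far₁ far₂ =
    -- The middle vertex ends one path and starts the next, since `inject₁ (suc i)` computes to
    -- `suc (inject₁ i)`.
    close-neighbours-unique G₅ col {y (suc (inject₁ i))} {v (inject₁ i)} {u (suc i)} (λ ())
      (bwd (vy (inject₁ i))) (fwd (yu (suc i)))
      ( proj₂ (block (inject₁ i) (far-from-x⇒≡ _ _ far₀ far₁))
      , proj₁ (block (suc i) (far-from-x⇒≡ _ _ far₁ far₂)))

  -- A close `y j` uses up the defect allowed at `x`, so the whole second half would be far, giving
  -- three consecutive far vertices.
  first-half-far : ∀ j → j ≢ 3F → j ≢ 4F → j ≢ 5F → ¬ CloseToX j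
  first-half-far j j≢3 j≢4 j≢5 close =
    ¬three-consecutive-far 3F (far j≢3) (far j≢4) (far j≢5)
    where
    far : ∀ {k} → j ≢ k → ¬ CloseToX k
    far {k} j≢k close′ =
      close-neighbours-unique G₅ col {x} (λ { refl → j≢k refl })
        (fwd (xy j)) (fwd (xy k)) (close , close′)

  ¬defect-1 : ⊥
  ¬defect-1 = ¬three-consecutive-far 0F
    (first-half-far 0F (λ ()) (λ ()) (λ ()))
    (first-half-far 1F (λ ()) (λ ()) (λ ()))
    (first-half-far 2F (λ ()) (λ ()) (λ ()))

theorem5p1 : Colorable G₅ 4 2 × ¬ Colorable G₅ 4 1
theorem5p1 = G₅-colorable-4-2 , λ (_ , col) → ¬defect-1 col
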